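{- There exist a constant $c>0$ and an infinite family of additive triples of DAGs $(G_1,G_2,G_3)$, where $G_i = (V, E_i)$, $n = |V|$ and $m = |E_1| + |E_2| + |E_3|$, with $n+m$ unbounded over the family, such that for every triple in the family, every 3-topological order preserver $(h_1,h_2,h_3)$ of $(G_1,G_2,G_3)$ satisfies $$\mathrm{range}(h_1,h_2,h_3) \ge 2^{c(n+m)}$$ (that is, $\mathrm{range}(h_1,h_2,h_3)\ge 2^{\Omega(n+m)}$).
   Context: Graphs are finite. For a DAG $G=(V,E)$, a topological ordering is a function $h:V\to\mathbb R$ with $h(u)+1\le h(v)$ for all $(u,v)\in E$. A triple $(G_1,G_2,G_3)$ of DAGs $G_i=(V,E_i)$ on the same vertex set is an additive triple if there exist topological orderings $h_i$ of $G_i$ ($i=1,2,3$) with $h_1(v)+h_2(v)=h_3(v)$ for all $v\in V$; any such $(h_1,h_2,h_3)$ is called a 3-topological order preserver of $(G_1,G_2,G_3)$. Its range is $\mathrm{range}(h_1,h_2,h_3):=\max_{i\in\{1,2,3\}}\left(\max_{v\in V}h_i(v)-\min_{v\in V}h_i(v)\right)$. -}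

module Defs where

open import Data.Fin using (Fin)
open import Data.Integer as ℤ using (ℤ; +_; -[1+_])
import Data.Integer.Properties as ℤP
open import Data.List using (List; length)
open import Data.List.Membership.Propositional using (_∈_)
open import Data.List.Relation.Unary.Unique.Propositional using (Unique)
open import Data.Nat as ℕ using (ℕ; zero; suc; z≤n; s≤s)
import Data.Nat.Properties as ℕP
import Data.Nat.Solver as ℕSolver
open import Data.Product using (_×_; _,_; ∃-syntax)
open import Data.Rational as ℚ using (ℚ; 0ℚ; 1ℚ)
import Data.Rational.Properties as ℚP
open import Data.Rational.Solver using (module +-*-Solver)
open import Data.Rational.Unnormalised as ℚᵘ using (mkℚᵘ)
import Data.Rational.Unnormalised.Properties as ℚᵘP
open import Data.Sum using (inj₁; inj₂)
import Data.Vec as Vec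
open import Relation.Binary.Construct.Closure.Transitive using (TransClosure)
open import Relation.Binary.PropositionalEquality
  using (_≡_; refl; sym; trans; cong; cong₂; subst; subst₂)
open import Relation.Nullary using (¬_; yes; no)

-- Real numbers: Bishop's regular sequences of rationals, indexed from 0,
-- so that the n-th term is within 1/(n+1) of the limit.

δ : ℕ → ℚ
δ n = + 1 ℚ./ suc n

IsRegular : (ℕ → ℚ) → Set
IsRegular x = ∀ m n → ℚ.∣ x m ℚ.- x n ∣ ℚ.≤ δ m ℚ.+ δ n

record ℝ : Set where
  constructor mkℝ
  field
    seq     : ℕ → ℚ
    regular : IsRegular seq

open ℝ public

infix 4 _≈ℝ_ _≤ℝ_ _≥ℝ_

_≈ℝ_ : ℝ → ℝ → Set
x ≈ℝ y = ∀ n → ℚ.∣ seq x n ℚ.- seq y n ∣ ℚ.≤ δ n ℚ.+ δ n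

_≤ℝ_ : ℝ → ℝ → Set
x ≤ℝ y = ∀ n → seq x n ℚ.≤ seq y n ℚ.+ (δ n ℚ.+ δ n)

_≥ℝ_ : ℝ → ℝ → Set
x ≥ℝ y = y ≤ℝ x

OneSided : (ℕ → ℚ) → Set
OneSided x = ∀ m n → x m ℚ.≤ x n ℚ.+ (δ m ℚ.+ δ n)

∣∣-lub : ∀ {p r} → p ℚ.≤ r → ℚ.- p ℚ.≤ r → ℚ.∣ p ∣ ℚ.≤ r
∣∣-lub {p} p≤r -p≤r with ℚP.∣p∣≡p∨∣p∣≡-p p
... | inj₁ eq = ℚP.≤-trans (ℚP.≤-reflexive eq) p≤r
... | inj₂ eq = ℚP.≤-trans (ℚP.≤-reflexive eq) -p≤r

p≤∣p∣ : ∀ p → p ℚ.≤ ℚ.∣ p ∣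
p≤∣p∣ p with ℚP.≤-total 0ℚ p
... | inj₁ 0≤p = ℚP.≤-reflexive (sym (ℚP.0≤p⇒∣p∣≡p 0≤p))
... | inj₂ p≤0 = ℚP.≤-trans p≤0 (ℚP.0≤∣p∣ p)

p≤q+r⇒p-q≤r : ∀ {p q r} → p ℚ.≤ q ℚ.+ r → p ℚ.- q ℚ.≤ r
p≤q+r⇒p-q≤r {p} {q} {r} h =
  ℚP.≤-trans (ℚP.+-monoˡ-≤ (ℚ.- q) h)
    (ℚP.≤-reflexive (solve 2 (λ q r → (q :+ r) :- q := r) refl q r))
  where open +-*-Solver

p-q≤r⇒p≤q+r : ∀ {p q r} → p ℚ.- q ℚ.≤ r → p ℚ.≤ q ℚ.+ r
p-q≤r⇒p≤q+r {p} {q} {r} h =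
  ℚP.≤-trans (ℚP.≤-reflexive (solve 2 (λ p q → p := q :+ (p :- q)) refl p q))
    (ℚP.+-monoʳ-≤ q h)
  where open +-*-Solver

oneSided : ∀ x → OneSided (seq x)
oneSided x m n = p-q≤r⇒p≤q+r (ℚP.≤-trans (p≤∣p∣ _) (regular x m n))

fromOneSided : ∀ x → OneSided x → ℝ
fromOneSided x os = mkℝ x λ m n → ∣∣-lub (p≤q+r⇒p-q≤r (os m n))
  (subst₂ ℚ._≤_ (solve 2 (λ p q → q :- p := :- (p :- q)) refl (x m) (x n))
    (ℚP.+-comm (δ n) (δ m)) (p≤q+r⇒p-q≤r (os n m)))
  where open +-*-Solver

δ-nonNeg : ∀ n → 0ℚ ℚ.≤ δ n
δ-nonNeg n = ℚP.nonNegative⁻¹ (δ n) {{ℚP.normalize-nonNeg 1 (suc n)}}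

fromℚ : ℚ → ℝ
fromℚ q = fromOneSided (λ _ → q) (λ m n →
  ℚP.≤-trans (ℚP.≤-reflexive (sym (ℚP.+-identityʳ q)))
    (ℚP.+-monoʳ-≤ q (ℚP.+-mono-≤ (δ-nonNeg m) (δ-nonNeg n))))

1ℝ : ℝ
1ℝ = fromℚ 1ℚ

-- The index 2n+1 carries the precision δ n / 2.
double : ℕ → ℕ
double n = n ℕ.+ suc n

δ-double : ∀ n → δ (double n) ℚ.+ δ (double n) ≡ δ n
δ-double n = ℚP.toℚᵘ-injective (begin
  ℚ.toℚᵘ (δ (double n) ℚ.+ δ (double n))           ≈⟨ ℚP.toℚᵘ-homo-+ (δ (double n)) (δ (double n)) ⟩
  ℚ.toℚᵘ (δ (double n)) ℚᵘ.+ ℚ.toℚᵘ (δ (double n)) ≈⟨ ℚᵘP.+-cong (ℚP.toℚᵘ-fromℚᵘ d) (ℚP.toℚᵘ-fromℚᵘ d) ⟩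
  d ℚᵘ.+ d                                         ≈⟨ ℚᵘ.*≡* lem ⟩
  mkℚᵘ (+ 1) n                                     ≈⟨ ℚP.toℚᵘ-fromℚᵘ (mkℚᵘ (+ 1) n) ⟨
  ℚ.toℚᵘ (δ n)                                     ∎)
  where
  open import Relation.Binary.Reasoning.Setoid ℚᵘP.≃-setoid
  d = mkℚᵘ (+ 1) (double n)
  open ℕSolver.+-*-Solver
  lem : (+ 1 ℤ.* + suc (double n) ℤ.+ + 1 ℤ.* + suc (double n)) ℤ.* + suc n
        ≡ + 1 ℤ.* + (suc (double n) ℕ.* suc (double n))
  lem = trans
    (cong (ℤ._* + suc n) (cong₂ ℤ._+_ (ℤP.*-identityˡ (+ suc (double n)))
                                       (ℤP.*-identityˡ (+ suc (double n)))))
    (trans (sym (ℤP.pos-* (suc (double n) ℕ.+ suc (double n)) (suc n)))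
    (trans (cong +_ (solve 1
        (λ x → let D = con 1 :+ (x :+ (con 1 :+ x)) in (D :+ D) :* (con 1 :+ x) := D :* D)
        refl n))
      (sym (ℤP.*-identityˡ _))))

infixl 6 _+ℝ_ _-ℝ_ _⊔ℝ_
infixl 7 _⊓ℝ_
infix  8 -ℝ_

_+ℝ_ : ℝ → ℝ → ℝ
x +ℝ y = fromOneSided (λ n → seq x (double n) ℚ.+ seq y (double n)) (λ m n →
  ℚP.≤-trans
    (ℚP.+-mono-≤ (oneSided x (double m) (double n))
                 (oneSided y (double m) (double n)))
    (ℚP.≤-reflexive (trans
      (solve 4 (λ a b p q → (a :+ (p :+ q)) :+ (b :+ (p :+ q)) := (a :+ b) :+ ((p :+ p) :+ (q :+ q)))
        refl (seq x (double n)) (seq y (double n)) (δ (double m)) (δ (double n)))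
      (cong₂ (λ p q → (seq x (double n) ℚ.+ seq y (double n)) ℚ.+ (p ℚ.+ q))
        (δ-double m) (δ-double n)))))
  where open +-*-Solver

-ℝ_ : ℝ → ℝ
-ℝ x = mkℝ (λ n → ℚ.- seq x n) λ m n →
  subst (ℚ._≤ δ m ℚ.+ δ n)
    (trans (sym (ℚP.∣-p∣≡∣p∣ (seq x m ℚ.- seq x n)))
      (cong ℚ.∣_∣ (ℚP.neg-distrib-+ (seq x m) (ℚ.- seq x n))))
    (regular x m n)

_-ℝ_ : ℝ → ℝ → ℝ
x -ℝ y = x +ℝ (-ℝ y)

_⊔ℝ_ : ℝ → ℝ → ℝ
x ⊔ℝ y = fromOneSided (λ n → seq x n ℚ.⊔ seq y n) (λ m n → ℚP.⊔-lub
  (ℚP.≤-trans (oneSided x m n)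
    (ℚP.+-monoˡ-≤ (δ m ℚ.+ δ n) (ℚP.p≤p⊔q (seq x n) (seq y n))))
  (ℚP.≤-trans (oneSided y m n)
    (ℚP.+-monoˡ-≤ (δ m ℚ.+ δ n) (ℚP.p≤q⊔p (seq x n) (seq y n)))))

_⊓ℝ_ : ℝ → ℝ → ℝ
x ⊓ℝ y = fromOneSided (λ n → seq x n ℚ.⊓ seq y n) step
  where
  step : OneSided (λ n → seq x n ℚ.⊓ seq y n)
  step m n with ℚP.⊓-sel (seq x n) (seq y n)
  ... | inj₁ eq = ℚP.≤-trans (ℚP.p⊓q≤p (seq x m) (seq y m))
                    (subst (λ z → seq x m ℚ.≤ z ℚ.+ (δ m ℚ.+ δ n)) (sym eq)
                      (oneSided x m n))
  ... | inj₂ eq = ℚP.≤-trans (ℚP.p⊓q≤q (seq x m) (seq y m))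
                    (subst (λ z → seq y m ℚ.≤ z ℚ.+ (δ m ℚ.+ δ n)) (sym eq)
                      (oneSided y m n))

-- The largest k ≤ bound with k ^ q * d ≤ e (for q > 0).
root : (q d e bound : ℕ) → ℕ
root q d e zero    = 0
root q d e (suc b) with suc b ℕ.^ q ℕ.* d ℕ.≤? e
... | yes _ = suc b
... | no  _ = root q d e b

posPart negPart : ℤ → ℕ
posPart (+ n)    = n
posPart -[1+ n ] = 0
negPart (+ n)    = 0
negPart -[1+ n ] = suc n

-- For r = p / q in lowest terms, 2^⌊ r ⌋ n is the integer part of
-- (n+1) · 2^(p/q), i.e. the largest k with k^q · 2^p⁻ ≤ 2^p⁺ · (n+1)^q;
-- such k is at most the right-hand side, which bounds the search.
2^⌊_⌋ : ℚ → ℕ → ℕ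
2^⌊ r ⌋ n = root (ℚ.↧ₙ r) (2 ℕ.^ negPart (ℚ.↥ r)) e e
  where e = 2 ℕ.^ posPart (ℚ.↥ r) ℕ.* suc n ℕ.^ ℚ.↧ₙ r

root-lower : ∀ q d e b → root (suc q) d e b ℕ.^ suc q ℕ.* d ℕ.≤ e
root-lower q d e zero    = z≤n
root-lower q d e (suc b) with suc b ℕ.^ suc q ℕ.* d ℕ.≤? e
... | yes p = p
... | no  _ = root-lower q d e b

root-max : ∀ q d e b j → j ℕ.≤ b → j ℕ.^ suc q ℕ.* d ℕ.≤ e → j ℕ.≤ root (suc q) d e b
root-max q d e zero    j j≤b h = j≤b
root-max q d e (suc b) j j≤b h with suc b ℕ.^ suc q ℕ.* d ℕ.≤? e
... | yes _ = j≤b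
... | no ¬p with ℕP.m≤n⇒m<n∨m≡n j≤b
...   | inj₁ (s≤s j≤b′) = root-max q d e b j j≤b′ h
...   | inj₂ refl with () ← ¬p h

root-upper : ∀ q d e .{{_ : ℕ.NonZero d}} → e ℕ.< suc (root (suc q) d e e) ℕ.^ suc q ℕ.* d
root-upper q d e = ℕP.≰⇒> λ h → ℕP.n≮n _ (root-max q d e e _ (≤e h) h)
  where
  k = suc (root (suc q) d e e)
  ≤e : k ℕ.^ suc q ℕ.* d ℕ.≤ e → k ℕ.≤ e
  ≤e h = ℕP.≤-trans (ℕP.≤-trans
    (ℕP.m≤m*n k (k ℕ.^ q) {{ℕP.m^n≢0 k q}}) (ℕP.m≤m*n _ d)) h

^-distribʳ-* : ∀ m n o → (m ℕ.* n) ℕ.^ o ≡ m ℕ.^ o ℕ.* n ℕ.^ o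
^-distribʳ-* m n zero    = refl
^-distribʳ-* m n (suc o) = trans (cong (m ℕ.* n ℕ.*_) (^-distribʳ-* m n o))
  (ℕP.[m*n]*[o*p]≡[m*o]*[n*p] m n (m ℕ.^ o) (n ℕ.^ o))

root-cross : ∀ q d c m n .{{_ : ℕ.NonZero d}} →
  let k = λ i → root (suc q) d (c ℕ.* suc i ℕ.^ suc q) (c ℕ.* suc i ℕ.^ suc q) in
  k m ℕ.* suc n ℕ.≤ suc (k n) ℕ.* suc m
root-cross q d c m n = ℕP.≮⇒≥ λ lt → ℕP.<-irrefl refl (begin-strict
  c ℕ.* M ℕ.* N                          ≡⟨ swap c M N ⟩
  c ℕ.* N ℕ.* M                          <⟨ ℕP.*-monoˡ-< M {{ℕP.m^n≢0 (suc m) Q}} (root-upper q d (c ℕ.* N)) ⟩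
  suc (k n) ℕ.^ Q ℕ.* d ℕ.* M            ≡⟨ swap (suc (k n) ℕ.^ Q) d M ⟩
  suc (k n) ℕ.^ Q ℕ.* M ℕ.* d            ≡⟨ cong (ℕ._* d) (^-distribʳ-* (suc (k n)) (suc m) Q) ⟨
  (suc (k n) ℕ.* suc m) ℕ.^ Q ℕ.* d      ≤⟨ ℕP.*-monoˡ-≤ d (ℕP.^-monoˡ-≤ Q (ℕP.<⇒≤ lt)) ⟩
  (k m ℕ.* suc n) ℕ.^ Q ℕ.* d            ≡⟨ cong (ℕ._* d) (^-distribʳ-* (k m) (suc n) Q) ⟩
  k m ℕ.^ Q ℕ.* N ℕ.* d                  ≡⟨ swap (k m ℕ.^ Q) N d ⟩
  k m ℕ.^ Q ℕ.* d ℕ.* N                  ≤⟨ ℕP.*-monoˡ-≤ N (root-lower q d (c ℕ.* M) (c ℕ.* M)) ⟩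
  c ℕ.* M ℕ.* N                          ∎)
  where
  open ℕP.≤-Reasoning
  Q = suc q
  M = suc m ℕ.^ Q
  N = suc n ℕ.^ Q
  k : ℕ → ℕ
  k i = root Q d (c ℕ.* suc i ℕ.^ Q) (c ℕ.* suc i ℕ.^ Q)
  swap : ∀ a b c → a ℕ.* b ℕ.* c ≡ a ℕ.* c ℕ.* b
  swap a b c = trans (ℕP.*-assoc a b c)
    (trans (cong (a ℕ.*_) (ℕP.*-comm b c)) (sym (ℕP.*-assoc a c b)))

cross⇒≤ : ∀ a b m n → a ℕ.* suc n ℕ.≤ suc b ℕ.* suc m →
  + a ℚ./ suc m ℚ.≤ + b ℚ./ suc n ℚ.+ δ n
cross⇒≤ a b m n h = ℚP.toℚᵘ-cancel-≤ (begin
  ℚ.toℚᵘ (+ a ℚ./ suc m)                      ≃⟨ ℚP.toℚᵘ-fromℚᵘ (mkℚᵘ (+ a) m) ⟩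
  mkℚᵘ (+ a) m                                ≤⟨ ℚᵘ.*≤* (subst₂ ℤ._≤_ (ℤP.pos-* a (suc n)) (ℤP.pos-* (suc b) (suc m)) (ℤ.+≤+ h)) ⟩
  mkℚᵘ (+ suc b) n                            ≃⟨ ℚᵘ.*≡* lem ⟩
  mkℚᵘ (+ b) n ℚᵘ.+ mkℚᵘ (+ 1) n              ≃⟨ ℚᵘP.+-cong (ℚP.toℚᵘ-fromℚᵘ (mkℚᵘ (+ b) n)) (ℚP.toℚᵘ-fromℚᵘ (mkℚᵘ (+ 1) n)) ⟨
  ℚ.toℚᵘ (+ b ℚ./ suc n) ℚᵘ.+ ℚ.toℚᵘ (δ n)    ≃⟨ ℚP.toℚᵘ-homo-+ (+ b ℚ./ suc n) (δ n) ⟨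
  ℚ.toℚᵘ (+ b ℚ./ suc n ℚ.+ δ n)              ∎)
  where
  open ℚᵘP.≤-Reasoning
  s = + suc n
  lem : + suc b ℤ.* + (suc n ℕ.* suc n) ≡ (+ b ℤ.* s ℤ.+ + 1 ℤ.* s) ℤ.* s
  lem = trans (cong (+ suc b ℤ.*_) (ℤP.pos-* (suc n) (suc n)))
    (trans (sym (ℤP.*-assoc (+ suc b) s s))
      (cong (ℤ._* s) (trans (cong (λ z → + z ℤ.* s) (sym (ℕP.+-comm b 1)))
        (ℤP.*-distribʳ-+ s (+ b) (+ 1)))))

infix 9 2^_

2^_ : ℚ → ℝ
2^ r = fromOneSided (λ n → + (2^⌊ r ⌋ n) ℚ./ suc n) (λ m n →
  ℚP.≤-trans
    (cross⇒≤ (2^⌊ r ⌋ m) (2^⌊ r ⌋ n) m n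
      (root-cross (ℚ.ℚ.denominator-1 r) (2 ℕ.^ negPart (ℚ.↥ r)) (2 ℕ.^ posPart (ℚ.↥ r)) m n
        {{ℕP.m^n≢0 2 (negPart (ℚ.↥ r))}}))
    (ℚP.+-monoʳ-≤ (+ (2^⌊ r ⌋ n) ℚ./ suc n)
      (ℚP.≤-trans (ℚP.≤-reflexive (sym (ℚP.+-identityˡ (δ n))))
        (ℚP.+-monoˡ-≤ (δ n) (δ-nonNeg m)))))

record DAG (n : ℕ) : Set where
  field
    edges  : List (Fin n × Fin n)
    unique : Unique edges

  _⟶_ : Fin n → Fin n → Set
  u ⟶ v = (u , v) ∈ edges

  field
    acyclic : ∀ v → ¬ TransClosure _⟶_ v v

  ∣E∣ : ℕ
  ∣E∣ = length edges

IsTopologicalOrdering : ∀ {n} → DAG n → (Fin n → ℝ) → Set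
IsTopologicalOrdering G h = ∀ u v → u ⟶ v → (h u +ℝ 1ℝ) ≤ℝ h v
  where open DAG G

record IsOrderPreserver {n} (G₁ G₂ G₃ : DAG n) (h₁ h₂ h₃ : Fin n → ℝ) : Set where
  field
    ordering₁ : IsTopologicalOrdering G₁ h₁
    ordering₂ : IsTopologicalOrdering G₂ h₂
    ordering₃ : IsTopologicalOrdering G₃ h₃
    additive  : ∀ v → (h₁ v +ℝ h₂ v) ≈ℝ h₃ v

-- The common vertex set is nonempty, so that maxima over it exist.
record AdditiveTriple : Set where
  field
    n-1 : ℕ

  n : ℕ
  n = suc n-1

  field
    G₁ G₂ G₃   : DAG n
    isAdditive : ∃[ h₁ ] ∃[ h₂ ] ∃[ h₃ ] IsOrderPreserver G₁ G₂ G₃ h₁ h₂ h₃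

  m : ℕ
  m = DAG.∣E∣ G₁ ℕ.+ DAG.∣E∣ G₂ ℕ.+ DAG.∣E∣ G₃

maxV minV : ∀ {k} → (Fin (suc k) → ℝ) → ℝ
maxV h = Vec.foldr₁ _⊔ℝ_ (Vec.tabulate h)
minV h = Vec.foldr₁ _⊓ℝ_ (Vec.tabulate h)

range : ∀ {k} (h₁ h₂ h₃ : Fin (suc k) → ℝ) → ℝ
range h₁ h₂ h₃ = (maxV h₁ -ℝ minV h₁) ⊔ℝ (maxV h₂ -ℝ minV h₂) ⊔ℝ (maxV h₃ -ℝ minV h₃)

{-# OPTIONS --safe #-}
module Submission where

-- Fix an apex p and build the graphs in levels, each adding the vertices
-- left l, right r and a new base q' below the previous base q.  With
-- x = h₁, y = h₂ and z = x + y, suppose z p - z q ≥ d.  The edge l → q of G₃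
-- and the edge p → l of G₂ give x p - x l ≥ d; the edge q' → l of G₁ then gives
-- x p - x q' ≥ d.  Symmetrically, through r, y p - y q' ≥ d, so z p - z q' ≥ 2d
-- (each edge also adds a positive constant).  A level costs three vertices and
-- six edges, so the range doubles at a cost of 9 in n + m.

open import Defs
open import Data.Fin using (Fin; zero; suc)
open import Data.Integer as ℤ using (+_; -[1+_])
import Data.Integer.Properties as ℤP
open import Data.List using (List; []; _∷_; length; map)
open import Data.List.Properties using (length-map)
open import Data.List.Membership.Propositional using (_∈_)
open import Data.List.Relation.Unary.All as All using (All; []; _∷_)
import Data.List.Relation.Unary.All.Properties as AllP
open import Data.List.Relation.Unary.AllPairs using ([]; _∷_)
open import Data.List.Relation.Unary.Unique.Propositional using (Unique)
import Data.List.Relation.Unary.Unique.Propositional.Properties as UniqueP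
open import Data.Nat as ℕ using (ℕ; zero; suc; _+_; _≤_; s≤s; z≤n)
import Data.Nat.Properties as ℕP
import Data.Nat.Solver as ℕSolver
open import Data.Product using (_×_; _,_; ∃-syntax; Σ-syntax)
open import Data.Rational as ℚ using (ℚ; 0ℚ; 1ℚ; _<_; _*_; _/_)
import Data.Rational.Properties as ℚP
open import Data.Rational.Solver using (module +-*-Solver)
open import Data.Rational.Unnormalised as ℚᵘ using (mkℚᵘ)
import Data.Rational.Unnormalised.Properties as ℚᵘP
open import Function using (_∘_)
open import Relation.Binary.Construct.Closure.Transitive using (TransClosure; [_]; _∷_)
open import Relation.Binary.PropositionalEquality
  using (_≡_; refl; sym; trans; cong; cong₂; subst; subst₂)
open import Relation.Nullary.Decidable using (from-yes)

open +-*-Solver using (solve; con; _:+_; _:-_; _:=_; :-_)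

-- Linear inequalities over the rationals.

-- Reduces linear arithmetic to a ring identity: the hypotheses are added up to `p ≤ q`, and the
-- ring solver checks that this has the same slack as the goal.
≤-by-difference : ∀ {a b p q} → p ℚ.≤ q → q ℚ.- p ≡ b ℚ.- a → a ℚ.≤ b
≤-by-difference {a} {b} {p} {q} p≤q eq = begin
  a                  ≡⟨ solve 2 (λ a p → a := p :+ (a :- p)) refl a p ⟩
  p ℚ.+ (a ℚ.- p)    ≤⟨ ℚP.+-monoˡ-≤ (a ℚ.- p) p≤q ⟩
  q ℚ.+ (a ℚ.- p)    ≡⟨ solve 3 (λ a p q → q :+ (a :- p) := a :+ (q :- p)) refl a p q ⟩
  a ℚ.+ (q ℚ.- p)    ≡⟨ cong (a ℚ.+_) eq ⟩
  a ℚ.+ (b ℚ.- a)    ≡⟨ solve 2 (λ a b → a :+ (b :- a) := b) refl a b ⟩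
  b                  ∎
  where open ℚP.≤-Reasoning

/-mono-≤ : ∀ a b m n → a ℕ.* suc n ℕ.≤ b ℕ.* suc m → + a / suc m ℚ.≤ + b / suc n
/-mono-≤ a b m n h = ℚP.toℚᵘ-cancel-≤ (begin
  ℚ.toℚᵘ (+ a / suc m)  ≃⟨ ℚP.toℚᵘ-fromℚᵘ (mkℚᵘ (+ a) m) ⟩
  mkℚᵘ (+ a) m          ≤⟨ ℚᵘ.*≤* (subst₂ ℤ._≤_ (ℤP.pos-* a (suc n)) (ℤP.pos-* b (suc m)) (ℤ.+≤+ h)) ⟩
  mkℚᵘ (+ b) n          ≃⟨ ℚP.toℚᵘ-fromℚᵘ (mkℚᵘ (+ b) n) ⟨
  ℚ.toℚᵘ (+ b / suc n)  ∎)
  where open ℚᵘP.≤-Reasoning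

-- Upper bounds for powers of two with rational exponent.

fromℕ : ℕ → ℚ
fromℕ k = + k / 1

fromℕ-+ : ∀ a b → fromℕ (a + b) ≡ fromℕ a ℚ.+ fromℕ b
fromℕ-+ a b = ℚP.toℚᵘ-injective (begin
  ℚ.toℚᵘ (fromℕ (a + b))                    ≈⟨ ℚP.toℚᵘ-fromℚᵘ (mkℚᵘ (+ (a + b)) 0) ⟩
  mkℚᵘ (+ (a + b)) 0                        ≈⟨ ℚᵘ.*≡* (cong (ℤ._* + 1) (sym (cong₂ ℤ._+_ (ℤP.*-identityʳ (+ a)) (ℤP.*-identityʳ (+ b))))) ⟩
  mkℚᵘ (+ a) 0 ℚᵘ.+ mkℚᵘ (+ b) 0            ≈⟨ ℚᵘP.+-cong (ℚP.toℚᵘ-fromℚᵘ (mkℚᵘ (+ a) 0)) (ℚP.toℚᵘ-fromℚᵘ (mkℚᵘ (+ b) 0)) ⟨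
  ℚ.toℚᵘ (fromℕ a) ℚᵘ.+ ℚ.toℚᵘ (fromℕ b)    ≈⟨ ℚP.toℚᵘ-homo-+ (fromℕ a) (fromℕ b) ⟨
  ℚ.toℚᵘ (fromℕ a ℚ.+ fromℕ b)              ∎)
  where open import Relation.Binary.Reasoning.Setoid ℚᵘP.≃-setoid

posPart-≤ : ∀ z a → z ℤ.≤ + a → posPart z ℕ.≤ a
posPart-≤ (+ p)    a (ℤ.+≤+ p≤a) = p≤a
posPart-≤ -[1+ _ ] a _           = z≤n

numerator-≤ : ∀ r K → r ℚ.≤ fromℕ K → posPart (ℚ.↥ r) ℕ.≤ K ℕ.* ℚ.↧ₙ r
numerator-≤ r@record{} K r≤K
  with ℚᵘ.*≤* h ← ℚᵘP.≤-trans (ℚP.toℚᵘ-mono-≤ r≤K) (ℚᵘP.≤-reflexive (ℚP.toℚᵘ-fromℚᵘ (mkℚᵘ (+ K) 0)))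
  = posPart-≤ (ℚ.↥ r) _ (subst₂ ℤ._≤_ (ℤP.*-identityʳ (ℚ.↥ r)) (sym (ℤP.pos-* K (ℚ.↧ₙ r))) h)

^-cancelˡ-≤ : ∀ q a b → a ℕ.^ suc q ℕ.≤ b ℕ.^ suc q → a ℕ.≤ b
^-cancelˡ-≤ q a b h = ℕP.≮⇒≥ λ b<a → ℕP.<⇒≱ (ℕP.^-monoˡ-< (suc q) b<a) h

-- Compare `q`-th powers, `q` being the denominator of `r`: the floor satisfies the inequality
-- defining `root`, and `r ≤ K` bounds the numerator by `K * q`.
2^⌊⌋-≤ : ∀ r K → r ℚ.≤ fromℕ K → ∀ n → 2^⌊ r ⌋ n ℕ.≤ 2 ℕ.^ K ℕ.* suc n
2^⌊⌋-≤ r K r≤K n = ^-cancelˡ-≤ (ℚ.ℚ.denominator-1 r) _ _ (begin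
  2^⌊ r ⌋ n ℕ.^ q                  ≤⟨ ℕP.m≤m*n _ d {{ℕP.m^n≢0 2 (negPart (ℚ.↥ r))}} ⟩
  2^⌊ r ⌋ n ℕ.^ q ℕ.* d            ≤⟨ root-lower (ℚ.ℚ.denominator-1 r) d e e ⟩
  e                                ≤⟨ ℕP.*-monoˡ-≤ (suc n ℕ.^ q) (ℕP.^-monoʳ-≤ 2 (numerator-≤ r K r≤K)) ⟩
  2 ℕ.^ (K ℕ.* q) ℕ.* suc n ℕ.^ q  ≡⟨ cong (ℕ._* suc n ℕ.^ q) (ℕP.^-*-assoc 2 K q) ⟨
  (2 ℕ.^ K) ℕ.^ q ℕ.* suc n ℕ.^ q  ≡⟨ ^-distribʳ-* (2 ℕ.^ K) (suc n) q ⟨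
  (2 ℕ.^ K ℕ.* suc n) ℕ.^ q        ∎)
  where
  open ℕP.≤-Reasoning
  q = ℚ.↧ₙ r
  d = 2 ℕ.^ negPart (ℚ.↥ r)
  e = 2 ℕ.^ posPart (ℚ.↥ r) ℕ.* suc n ℕ.^ q

-- The approximants are rounded down, so the bound carries no error term. This keeps the whole
-- tolerance of `≤ℝ` for the estimate of the range.
2^-≤ : ∀ r K → r ℚ.≤ fromℕ K → ∀ n → seq (2^ r) n ℚ.≤ fromℕ (2 ℕ.^ K)
2^-≤ r K r≤K n = /-mono-≤ (2^⌊ r ⌋ n) (2 ℕ.^ K) n 0
  (ℕP.≤-trans (ℕP.≤-reflexive (ℕP.*-identityʳ _)) (2^⌊⌋-≤ r K r≤K n))

tenth-≤ : ∀ N K → N ℕ.≤ K ℕ.* 10 → (+ 1 / 10) * fromℕ N ℚ.≤ fromℕ K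
tenth-≤ N K h = ℚP.toℚᵘ-cancel-≤ (begin
  ℚ.toℚᵘ ((+ 1 / 10) * fromℕ N)               ≃⟨ ℚP.toℚᵘ-homo-* (+ 1 / 10) (fromℕ N) ⟩
  mkℚᵘ (+ 1) 9 ℚᵘ.* ℚ.toℚᵘ (fromℕ N)          ≃⟨ ℚᵘP.*-congˡ {mkℚᵘ (+ 1) 9} (ℚP.toℚᵘ-fromℚᵘ (mkℚᵘ (+ N) 0)) ⟩
  mkℚᵘ (+ 1) 9 ℚᵘ.* mkℚᵘ (+ N) 0              ≤⟨ ℚᵘ.*≤* (subst₂ ℤ._≤_ (sym (trans (ℤP.*-identityʳ _) (ℤP.*-identityˡ (+ N)))) (ℤP.pos-* K 10) (ℤ.+≤+ h)) ⟩
  mkℚᵘ (+ K) 0                                ≃⟨ ℚP.toℚᵘ-fromℚᵘ (mkℚᵘ (+ K) 0) ⟨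
  ℚ.toℚᵘ (fromℕ K)                            ∎)
  where open ℚᵘP.≤-Reasoning

-- Terms of the range, and rational samples of reals.

maxV-upper : ∀ {k} (h : Fin (suc k) → ℝ) v n → seq (h v) n ℚ.≤ seq (maxV h) n
maxV-upper {zero}  h zero    n = ℚP.≤-refl
maxV-upper {suc k} h zero    n = ℚP.p≤p⊔q _ _
maxV-upper {suc k} h (suc v) n = ℚP.≤-trans (maxV-upper (h ∘ suc) v n) (ℚP.p≤q⊔p (seq (h zero) n) _)

minV-lower : ∀ {k} (h : Fin (suc k) → ℝ) v n → seq (minV h) n ℚ.≤ seq (h v) n
minV-lower {zero}  h zero    n = ℚP.≤-refl
minV-lower {suc k} h zero    n = ℚP.p⊓q≤p _ _
minV-lower {suc k} h (suc v) n = ℚP.≤-trans (ℚP.p⊓q≤q (seq (h zero) n) _) (minV-lower (h ∘ suc) v n)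

-- `⊔ℝ` and `⊓ℝ` act term by term, so no error arises; `-ℝ` reads its arguments at `double n`.
range-lower : ∀ {k} (h₁ h₂ h₃ : Fin (suc k) → ℝ) u v n →
  seq (h₁ v) (double n) ℚ.- seq (h₁ u) (double n) ℚ.≤ seq (range h₁ h₂ h₃) n
range-lower h₁ h₂ h₃ u v n = ℚP.≤-trans
  (ℚP.+-mono-≤ (maxV-upper h₁ v (double n)) (ℚP.neg-antimono-≤ (minV-lower h₁ u (double n))))
  (ℚP.≤-trans (ℚP.p≤p⊔q _ (seq (maxV h₂ -ℝ minV h₂) n)) (ℚP.p≤p⊔q _ _))

-- At index 59 the errors δ 59 = 1/60 and δ 119 = 1/120 are small enough that
-- every edge of G₁, G₂ and G₃ still forces a gap of 3/4 in h₁, h₂ and h₁ + h₂.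
sample : ℝ → ℚ
sample x = seq x 59

-- `x +ℝ 1ℝ` reads `x` at index 119 = `double 59`, and returning to 59 costs 1/60 + 1/120. Hence
-- 113/120 = 1 - 2/60 - (1/60 + 1/120).
sample-< : ∀ x y → (x +ℝ 1ℝ) ≤ℝ y → sample x ℚ.+ + 113 / 120 ℚ.≤ sample y
sample-< x y h = ≤-by-difference
  (ℚP.+-mono-≤ (h 59) (oneSided x 59 119))
  (solve 3 (λ a a′ b →
    ((b :+ (con (δ 59) :+ con (δ 59))) :+ (a′ :+ (con (δ 59) :+ con (δ 119))))
      :- ((a′ :+ con 1ℚ) :+ a)
    := b :- (a :+ con (+ 113 / 120)))
    refl (sample x) (seq x 119) (sample y))

-- 1/12 = 2/60 + 2(1/60 + 1/120): the tolerance of `≈ℝ`, then the change of index for both summands.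
sample-+-≤ : ∀ x y z → (x +ℝ y) ≈ℝ z → sample x ℚ.+ sample y ℚ.≤ sample z ℚ.+ + 1 / 12
sample-+-≤ x y z h = ≤-by-difference
  (ℚP.+-mono-≤ (ℚP.≤-trans (p≤∣p∣ _) (h 59)) (ℚP.+-mono-≤ (oneSided x 59 119) (oneSided y 59 119)))
  (solve 5 (λ a a′ b b′ c →
    ((con (δ 59) :+ con (δ 59))
        :+ ((a′ :+ (con (δ 59) :+ con (δ 119))) :+ (b′ :+ (con (δ 59) :+ con (δ 119)))))
      :- (((a′ :+ b′) :- c) :+ (a :+ b))
    := (c :+ con (+ 1 / 12)) :- (a :+ b))
    refl (sample x) (seq x 119) (sample y) (seq y 119) (sample z))

≤-sample-+ : ∀ x y z → (x +ℝ y) ≈ℝ z → sample z ℚ.≤ (sample x ℚ.+ sample y) ℚ.+ + 1 / 12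
≤-sample-+ x y z h = ≤-by-difference
  (ℚP.+-mono-≤
    (ℚP.≤-trans (p≤∣p∣ _) (subst (ℚ._≤ δ 59 ℚ.+ δ 59) (sym (ℚP.∣-p∣≡∣p∣ (seq (x +ℝ y) 59 ℚ.- sample z))) (h 59)))
    (ℚP.+-mono-≤ (oneSided x 119 59) (oneSided y 119 59)))
  (solve 5 (λ a a′ b b′ c →
    ((con (δ 59) :+ con (δ 59))
        :+ ((a :+ (con (δ 119) :+ con (δ 59))) :+ (b :+ (con (δ 119) :+ con (δ 59)))))
      :- ((:- ((a′ :+ b′) :- c)) :+ (a′ :+ b′))
    := ((a :+ b) :+ con (+ 1 / 12)) :- c)
    refl (sample x) (seq x 119) (sample y) (seq y 119) (sample z))

-- Acyclicity and orderings from a rational potential.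

Edges : ℕ → Set
Edges n = List (Fin n × Fin n)

Rises : ∀ {n} → ℚ → (Fin n → ℚ) → Edges n → Set
Rises g h = All λ (u , v) → h u ℚ.+ g ℚ.≤ h v

Graded : ∀ {n} → (Fin n → ℚ) → Edges n → Set
Graded h = All λ (u , v) → h u ℚ.+ 1ℚ ≡ h v

x<x+1 : ∀ x → x < x ℚ.+ 1ℚ
x<x+1 x = subst (_< x ℚ.+ 1ℚ) (ℚP.+-identityʳ x) (ℚP.+-monoʳ-< x (ℚP.positive⁻¹ 1ℚ))

-- A potential that strictly increases along edges excludes cycles, so each coordinate of the order
-- preserver built below also certifies acyclicity.
gradedDAG : ∀ {n} (E : Edges n) → Unique E → (h : Fin n → ℚ) → Graded h E → DAG n
gradedDAG E E! h graded = record
  { edges = E ; unique = E! ; acyclic = λ _ cycle → ℚP.<-irrefl refl (increasing cycle) }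
  where
  step : ∀ {u v} → (u , v) ∈ E → h u < h v
  step {u} uv = subst (h u <_) (All.lookup graded uv) (x<x+1 (h u))
  increasing : ∀ {u v} → TransClosure (λ u v → (u , v) ∈ E) u v → h u < h v
  increasing [ e ]    = step e
  increasing (e ∷ es) = ℚP.<-trans (step e) (increasing es)

δ+δ-nonNeg : ∀ n → 0ℚ ℚ.≤ δ n ℚ.+ δ n
δ+δ-nonNeg n = ℚP.+-mono-≤ (δ-nonNeg n) (δ-nonNeg n)

≡⇒≤+2δ : ∀ {p q} n → p ≡ q → p ℚ.≤ q ℚ.+ (δ n ℚ.+ δ n)
≡⇒≤+2δ {p} n refl = ℚP.≤-trans (ℚP.≤-reflexive (sym (ℚP.+-identityʳ p))) (ℚP.+-monoʳ-≤ p (δ+δ-nonNeg n))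

graded-ordering : ∀ {n} (G : DAG n) (h : Fin n → ℚ) → Graded h (DAG.edges G) →
  IsTopologicalOrdering G (fromℚ ∘ h)
graded-ordering G h graded u v uv n = ≡⇒≤+2δ n (All.lookup graded uv)

fromℚ-+ : ∀ p q → (fromℚ p +ℝ fromℚ q) ≈ℝ fromℚ (p ℚ.+ q)
fromℚ-+ p q n = subst (λ z → ℚ.∣ z ∣ ℚ.≤ δ n ℚ.+ δ n) (sym (ℚP.+-inverseʳ (p ℚ.+ q))) (δ+δ-nonNeg n)

-- The recursive construction of the graphs.

-- With `k ℕ.* 3`, adding a level reduces definitionally to three further `suc`s, which is what
-- `old` needs.
Vertex : ℕ → Set
Vertex k = Fin (suc (k ℕ.* 3))

old : ∀ {n} → Fin n → Fin (3 + n)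
old v = suc (suc (suc v))

old² : ∀ {n} → Fin n × Fin n → Fin (3 + n) × Fin (3 + n)
old² (u , v) = old u , old v

left right : ∀ {n} → Fin (3 + n)
left  = zero
right = suc zero

apex base : ∀ k → Vertex k
apex zero    = zero
apex (suc k) = old (apex k)
base zero    = zero
base (suc k) = suc (suc zero)

-- Exchanging `left` and `right` on every level exchanges the first two edge sets and preserves the
-- third; this is the symmetry between `gap-x` and `gap-y`.
E₁ E₂ E₃ : ∀ k → Edges (suc (k ℕ.* 3))
E₁ zero    = []
E₁ (suc k) = (apex (suc k) , right) ∷ (base (suc k) , left) ∷ map old² (E₁ k)
E₂ zero    = []
E₂ (suc k) = (apex (suc k) , left) ∷ (base (suc k) , right) ∷ map old² (E₂ k)
E₃ zero    = []
E₃ (suc k) = (left , old (base k)) ∷ (right , old (base k)) ∷ map old² (E₃ k)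

length-E₁ : ∀ k → length (E₁ k) ≡ k ℕ.* 2
length-E₁ zero    = refl
length-E₁ (suc k) = cong (2 ℕ.+_) (trans (length-map old² (E₁ k)) (length-E₁ k))

length-E₂ : ∀ k → length (E₂ k) ≡ k ℕ.* 2
length-E₂ zero    = refl
length-E₂ (suc k) = cong (2 ℕ.+_) (trans (length-map old² (E₂ k)) (length-E₂ k))

length-E₃ : ∀ k → length (E₃ k) ≡ k ℕ.* 2
length-E₃ zero    = refl
length-E₃ (suc k) = cong (2 ℕ.+_) (trans (length-map old² (E₃ k)) (length-E₃ k))

old²-injective : ∀ {n} {e f : Fin n × Fin n} → old² e ≡ old² f → e ≡ f
old²-injective {e = _ , _} {_ , _} refl = refl

-- Each new edge has an endpoint among the three new vertices, so it differs from every image under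
-- `old²`.
unique-E₁ : ∀ k → Unique (E₁ k)
unique-E₁ zero    = []
unique-E₁ (suc k) =
  ((λ ()) ∷ AllP.map⁺ (All.universal (λ _ ()) (E₁ k))) ∷
  AllP.map⁺ (All.universal (λ _ ()) (E₁ k)) ∷
  UniqueP.map⁺ old²-injective (unique-E₁ k)

unique-E₂ : ∀ k → Unique (E₂ k)
unique-E₂ zero    = []
unique-E₂ (suc k) =
  ((λ ()) ∷ AllP.map⁺ (All.universal (λ _ ()) (E₂ k))) ∷
  AllP.map⁺ (All.universal (λ _ ()) (E₂ k)) ∷
  UniqueP.map⁺ old²-injective (unique-E₂ k)

unique-E₃ : ∀ k → Unique (E₃ k)
unique-E₃ zero    = []
unique-E₃ (suc k) =
  ((λ ()) ∷ AllP.map⁺ (All.universal (λ _ ()) (E₃ k))) ∷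
  AllP.map⁺ (All.universal (λ _ ()) (E₃ k)) ∷
  UniqueP.map⁺ old²-injective (unique-E₃ k)

-- An explicit order preserver.

-- In closed form 3(2^k - 1): the drop from apex to base in each of `X` and `Y` when all edges are
-- tight. The doubling comes from the sum of the two equal drops, the 3 from the three unit edges
-- traversed.
depth : ℕ → ℚ
depth zero    = 0ℚ
depth (suc k) = (depth k ℚ.+ depth k) ℚ.+ fromℕ 3

-- Chosen so that along every edge the respective coordinate rises by exactly 1.
X Y Z : ∀ k → Vertex k → ℚ
X zero    _                   = 0ℚ
X (suc k) zero                = ℚ.- ((depth k ℚ.+ depth k) ℚ.+ fromℕ 2)
X (suc k) (suc zero)          = 1ℚ
X (suc k) (suc (suc zero))    = ℚ.- depth (suc k)
X (suc k) (suc (suc (suc v))) = X k v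
Y zero    _                   = 0ℚ
Y (suc k) zero                = 1ℚ
Y (suc k) (suc zero)          = ℚ.- ((depth k ℚ.+ depth k) ℚ.+ fromℕ 2)
Y (suc k) (suc (suc zero))    = ℚ.- depth (suc k)
Y (suc k) (suc (suc (suc v))) = Y k v
Z k v = X k v ℚ.+ Y k v

X-apex : ∀ k → X k (apex k) ≡ 0ℚ
X-apex zero    = refl
X-apex (suc k) = X-apex k

Y-apex : ∀ k → Y k (apex k) ≡ 0ℚ
Y-apex zero    = refl
Y-apex (suc k) = Y-apex k

X-base : ∀ k → X k (base k) ≡ ℚ.- depth k
X-base zero    = refl
X-base (suc k) = refl

Y-base : ∀ k → Y k (base k) ≡ ℚ.- depth k
Y-base zero    = refl
Y-base (suc k) = refl

base<side : ∀ d → (ℚ.- ((d ℚ.+ d) ℚ.+ fromℕ 3)) ℚ.+ 1ℚ ≡ ℚ.- ((d ℚ.+ d) ℚ.+ fromℕ 2)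
base<side = solve 1 (λ d → (:- ((d :+ d) :+ con (fromℕ 3))) :+ con 1ℚ
                             := :- ((d :+ d) :+ con (fromℕ 2))) refl

X-graded : ∀ k → Graded (X k) (E₁ k)
X-graded zero    = []
X-graded (suc k) = cong (ℚ._+ 1ℚ) (X-apex k) ∷ base<side (depth k) ∷ AllP.map⁺ (X-graded k)

Y-graded : ∀ k → Graded (Y k) (E₂ k)
Y-graded zero    = []
Y-graded (suc k) = cong (ℚ._+ 1ℚ) (Y-apex k) ∷ base<side (depth k) ∷ AllP.map⁺ (Y-graded k)

Z-graded : ∀ k → Graded (Z k) (E₃ k)
Z-graded zero    = []
Z-graded (suc k) =
  trans (solve 1 (λ d → ((:- ((d :+ d) :+ con (fromℕ 2))) :+ con 1ℚ) :+ con 1ℚ := (:- d) :+ (:- d)) refl (depth k)) base≡ ∷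
  trans (solve 1 (λ d → (con 1ℚ :+ (:- ((d :+ d) :+ con (fromℕ 2)))) :+ con 1ℚ := (:- d) :+ (:- d)) refl (depth k)) base≡ ∷
  AllP.map⁺ (Z-graded k)
  where
  base≡ : (ℚ.- depth k) ℚ.+ (ℚ.- depth k) ≡ Z k (base k)
  base≡ = sym (cong₂ ℚ._+_ (X-base k) (Y-base k))

triple : ℕ → AdditiveTriple
triple k = record
  { n-1 = k ℕ.* 3
  ; G₁  = D₁
  ; G₂  = D₂
  ; G₃  = D₃
  ; isAdditive = fromℚ ∘ X k , fromℚ ∘ Y k , fromℚ ∘ Z k , record
      { ordering₁ = graded-ordering D₁ (X k) (X-graded k)
      ; ordering₂ = graded-ordering D₂ (Y k) (Y-graded k)
      ; ordering₃ = graded-ordering D₃ (Z k) (Z-graded k)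
      ; additive  = λ v → fromℚ-+ (X k v) (Y k v)
      }
  }
  where
  D₁ = gradedDAG (E₁ k) (unique-E₁ k) (X k) (X-graded k)
  D₂ = gradedDAG (E₂ k) (unique-E₂ k) (Y k) (Y-graded k)
  D₃ = gradedDAG (E₃ k) (unique-E₃ k) (Z k) (Z-graded k)

size : ∀ k → AdditiveTriple.n (triple k) + AdditiveTriple.m (triple k) ≡ suc (k ℕ.* 9)
size k = trans
  (cong (suc (k ℕ.* 3) ℕ.+_) (cong₂ _+_ (cong₂ _+_ (length-E₁ k) (length-E₂ k)) (length-E₃ k)))
  (NS.solve 1 (λ k → (NS.con 1 NS.:+ k NS.:* NS.con 3)
        NS.:+ ((k NS.:* NS.con 2 NS.:+ k NS.:* NS.con 2) NS.:+ k NS.:* NS.con 2)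
      NS.:= NS.con 1 NS.:+ k NS.:* NS.con 9) refl k)
  where module NS = ℕSolver.+-*-Solver

-- Exponential growth of the gap between apex and base.

¾ : ℚ
¾ = + 3 / 4

-- Adding the four hypotheses cancels the old base, the side vertex and `y top`. The constant 9/4 is
-- `¾` for each of the three edges used.
new-base-gap : ∀ {n} (x y : Fin n → ℚ) side top old-base new-base d →
  y top ℚ.+ ¾ ℚ.≤ y side →
  (x side ℚ.+ y side) ℚ.+ ¾ ℚ.≤ x old-base ℚ.+ y old-base →
  (x old-base ℚ.+ y old-base) ℚ.+ d ℚ.≤ x top ℚ.+ y top →
  x new-base ℚ.+ ¾ ℚ.≤ x side →
  x new-base ℚ.+ (d ℚ.+ + 9 / 4) ℚ.≤ x top
new-base-gap x y s p b q d h₁ h₂ h₃ h₄ = ≤-by-difference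
  (ℚP.+-mono-≤ (ℚP.+-mono-≤ h₁ h₂) (ℚP.+-mono-≤ h₃ h₄))
  (solve 8 (λ xₛ yₛ xₚ yₚ xb yb xq d →
      ((yₛ :+ (xb :+ yb)) :+ ((xₚ :+ yₚ) :+ xₛ))
        :- (((yₚ :+ con ¾) :+ ((xₛ :+ yₛ) :+ con ¾)) :+ (((xb :+ yb) :+ d) :+ (xq :+ con ¾)))
      := xₚ :- (xq :+ (d :+ con (+ 9 / 4))))
    refl (x s) (y s) (x p) (y p) (x b) (y b) (x q) d)

-- In closed form (9/2)(2^k - 1).
gap : ℕ → ℚ
gap zero    = 0ℚ
gap (suc k) = (gap k ℚ.+ + 9 / 4) ℚ.+ (gap k ℚ.+ + 9 / 4)

-- The rational trace of an order preserver. The third field speaks of `x + y` itself rather than of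
-- samples of `h₃`, so that the induction on levels accumulates no error.
record Separated k (x y : Vertex k → ℚ) : Set where
  constructor separated
  field
    rises₁ : Rises ¾ x (E₁ k)
    rises₂ : Rises ¾ y (E₂ k)
    rises₃ : Rises ¾ (λ v → x v ℚ.+ y v) (E₃ k)

Separated-old : ∀ {k x y} → Separated (suc k) x y → Separated k (x ∘ old) (y ∘ old)
Separated-old (separated (_ ∷ _ ∷ r₁) (_ ∷ _ ∷ r₂) (_ ∷ _ ∷ r₃)) =
  separated (AllP.map⁻ r₁) (AllP.map⁻ r₂) (AllP.map⁻ r₃)

-- Mutual induction on levels: the gap of the sum at one level bounds each coordinate at the next,
-- and adding the two coordinates doubles it.
gap-+ : ∀ k x y → Separated k x y →
  (x (base k) ℚ.+ y (base k)) ℚ.+ gap k ℚ.≤ x (apex k) ℚ.+ y (apex k)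
gap-x : ∀ k x y → Separated (suc k) x y →
  x (base (suc k)) ℚ.+ (gap k ℚ.+ + 9 / 4) ℚ.≤ x (apex (suc k))
gap-y : ∀ k x y → Separated (suc k) x y →
  y (base (suc k)) ℚ.+ (gap k ℚ.+ + 9 / 4) ℚ.≤ y (apex (suc k))

gap-+ zero    x y sep = ℚP.≤-reflexive (ℚP.+-identityʳ _)
gap-+ (suc k) x y sep = ≤-by-difference (ℚP.+-mono-≤ (gap-x k x y sep) (gap-y k x y sep))
  (solve 5 (λ xb yb xa ya h → (xa :+ ya) :- ((xb :+ h) :+ (yb :+ h))
                              := (xa :+ ya) :- ((xb :+ yb) :+ (h :+ h)))
    refl (x (base (suc k))) (y (base (suc k))) (x (apex (suc k))) (y (apex (suc k))) (gap k ℚ.+ + 9 / 4))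
gap-x k x y sep@(separated (_ ∷ q<l ∷ _) (a<l ∷ _ ∷ _) (l<b ∷ _ ∷ _)) =
  new-base-gap x y left (apex (suc k)) (old (base k)) (base (suc k)) (gap k)
    a<l l<b (gap-+ k (x ∘ old) (y ∘ old) (Separated-old sep)) q<l
gap-y k x y sep@(separated (a<r ∷ _ ∷ _) (_ ∷ q<r ∷ _) (_ ∷ r<b ∷ _)) =
  -- The coordinates are exchanged together with the sides, so the sums have to be commuted.
  new-base-gap y x right (apex (suc k)) (old (base k)) (base (suc k)) (gap k)
    a<r (swap right (old (base k)) r<b)
    (swap (old (base k)) (old (apex k)) (gap-+ k (x ∘ old) (y ∘ old) (Separated-old sep))) q<r
  where
  swap : ∀ {g} u v → (x u ℚ.+ y u) ℚ.+ g ℚ.≤ x v ℚ.+ y v → (y u ℚ.+ x u) ℚ.+ g ℚ.≤ y v ℚ.+ x v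
  swap {g} u v = subst₂ ℚ._≤_ (cong (ℚ._+ g) (ℚP.+-comm (x u) (y u))) (ℚP.+-comm (x v) (y v))

-- `gap-x` provides `gap k + 9/4`, so bounding by `gap k + 2` saves 1/4 for sampling errors. The
-- base case is an equality; each doubling then leaves 2(9/4) + 2 - 4 = 5/2 to spare.
2^-gap : ∀ k → fromℕ (2 ℕ.^ suc k) ℚ.≤ gap k ℚ.+ fromℕ 2
2^-gap zero    = ℚP.≤-refl
2^-gap (suc k) = ≤-by-difference
  (ℚP.+-mono-≤ (ℚP.+-mono-≤ (2^-gap k) (2^-gap k)) (from-yes (0ℚ ℚP.≤? + 5 / 2)))
  (trans
    (solve 2 (λ p g →
        (((g :+ con (fromℕ 2)) :+ (g :+ con (fromℕ 2))) :+ con (+ 5 / 2)) :- ((p :+ p) :+ con 0ℚ)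
        := (((g :+ con (+ 9 / 4)) :+ (g :+ con (+ 9 / 4))) :+ con (fromℕ 2)) :- (p :+ p))
      refl (fromℕ (2 ℕ.^ suc k)) (gap k))
    (cong (λ p → (gap (suc k) ℚ.+ fromℕ 2) ℚ.- p) (sym double-2^)))
  where
  double-2^ : fromℕ (2 ℕ.^ suc (suc k)) ≡ fromℕ (2 ℕ.^ suc k) ℚ.+ fromℕ (2 ℕ.^ suc k)
  double-2^ = trans (cong (λ m → fromℕ (2 ℕ.^ suc k + m)) (ℕP.+-identityʳ (2 ℕ.^ suc k)))
                    (fromℕ-+ (2 ℕ.^ suc k) (2 ℕ.^ suc k))

-- From real order preservers to the lower bound on the range.

sample-separated : ∀ k → let open AdditiveTriple (triple k) in ∀ {h₁ h₂ h₃ : Fin n → ℝ} →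
  IsOrderPreserver G₁ G₂ G₃ h₁ h₂ h₃ → Separated k (sample ∘ h₁) (sample ∘ h₂)
sample-separated k {h₁} {h₂} {h₃} P = separated
  (All.tabulate λ {(u , v)} uv → weaken (sample (h₁ u)) (sample-< (h₁ u) (h₁ v) (ordering₁ u v uv)))
  (All.tabulate λ {(u , v)} uv → weaken (sample (h₂ u)) (sample-< (h₂ u) (h₂ v) (ordering₂ u v uv)))
  (All.tabulate λ {(u , v)} uv → sum-rises u v (sample-< (h₃ u) (h₃ v) (ordering₃ u v uv)))
  where
  open IsOrderPreserver P
  weaken : ∀ p {q} → p ℚ.+ + 113 / 120 ℚ.≤ q → p ℚ.+ ¾ ℚ.≤ q
  weaken p = ℚP.≤-trans (ℚP.+-monoʳ-≤ p (from-yes (¾ ℚP.≤? + 113 / 120)))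
  sum-rises : ∀ u v → sample (h₃ u) ℚ.+ + 113 / 120 ℚ.≤ sample (h₃ v) →
    (sample (h₁ u) ℚ.+ sample (h₂ u)) ℚ.+ ¾ ℚ.≤ sample (h₁ v) ℚ.+ sample (h₂ v)
  -- Passing from `h₃` to `h₁ + h₂` costs 1/12 at each end: 113/120 - 2/12 = 3/4 + 1/40.
  sum-rises u v z<z = ≤-by-difference
    (ℚP.+-mono-≤ (ℚP.+-mono-≤ z<z (from-yes (0ℚ ℚP.≤? + 1 / 40)))
      (ℚP.+-mono-≤ (sample-+-≤ (h₁ u) (h₂ u) (h₃ u) (additive u))
                   (≤-sample-+ (h₁ v) (h₂ v) (h₃ v) (additive v))))
    (solve 4 (λ a b c d →
        ((c :+ con (+ 1 / 40)) :+ ((b :+ con (+ 1 / 12)) :+ (d :+ con (+ 1 / 12))))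
          :- (((b :+ con (+ 113 / 120)) :+ con 0ℚ) :+ (a :+ c))
        := d :- (a :+ con ¾))
      refl (sample (h₁ u) ℚ.+ sample (h₂ u)) (sample (h₃ u)) (sample (h₃ v)) (sample (h₁ v) ℚ.+ sample (h₂ v)))

-- The bound from index 59 is transported to `double j` at the apex and at the base. The two errors
-- `δ (double j)` make up one `δ j` of the tolerance, and the two errors 1/60 come out of the saved
-- 1/4, leaving 13/60.
range-exponential : ∀ k → let open AdditiveTriple (triple (suc k)) in ∀ {h₁ h₂ h₃ : Fin n → ℝ} →
  IsOrderPreserver G₁ G₂ G₃ h₁ h₂ h₃ →
  ∀ j → fromℕ (2 ℕ.^ suc k) ℚ.≤ seq (range h₁ h₂ h₃) j ℚ.+ (δ j ℚ.+ δ j)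
range-exponential k {h₁} {h₂} {h₃} P j = subst
  (λ e → fromℕ (2 ℕ.^ suc k) ℚ.≤ seq (range h₁ h₂ h₃) j ℚ.+ (δ j ℚ.+ e)) (δ-double j)
  (≤-by-difference
    (ℚP.+-mono-≤
      (ℚP.+-mono-≤ (2^-gap k) (gap-x k (sample ∘ h₁) (sample ∘ h₂) (sample-separated (suc k) P)))
      (ℚP.+-mono-≤
        (ℚP.+-mono-≤ (oneSided (h₁ top) 59 (double j)) (oneSided (h₁ bot) (double j) 59))
        (ℚP.+-mono-≤ (range-lower h₁ h₂ h₃ bot top j)
          (ℚP.+-mono-≤ (δ-nonNeg j) (from-yes (0ℚ ℚP.≤? + 13 / 60))))))
    (solve 9 (λ p g xa xb ha hb r e d →
        (((g :+ con (fromℕ 2)) :+ xa)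
          :+ (((ha :+ (con (δ 59) :+ d)) :+ (xb :+ (d :+ con (δ 59))))
            :+ (r :+ (e :+ con (+ 13 / 60)))))
          :- ((p :+ (xb :+ (g :+ con (+ 9 / 4)))) :+ ((xa :+ hb) :+ ((ha :- hb) :+ (con 0ℚ :+ con 0ℚ))))
        := (r :+ (e :+ (d :+ d))) :- p)
      refl (fromℕ (2 ℕ.^ suc k)) (gap k) (sample (h₁ top)) (sample (h₁ bot))
        (seq (h₁ top) (double j)) (seq (h₁ bot) (double j)) (seq (range h₁ h₂ h₃) j) (δ j) (δ (double j))))
  where
  top = apex (suc k)
  bot = base (suc k)

size-≤ : ∀ k → AdditiveTriple.n (triple (suc k)) + AdditiveTriple.m (triple (suc k)) ≤ suc k ℕ.* 10
size-≤ k = begin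
  AdditiveTriple.n (triple (suc k)) + AdditiveTriple.m (triple (suc k))  ≡⟨ size (suc k) ⟩
  1 + suc k ℕ.* 9      ≤⟨ ℕP.+-monoˡ-≤ (suc k ℕ.* 9) (s≤s z≤n) ⟩
  suc k + suc k ℕ.* 9  ≡⟨ ℕP.*-suc (suc k) 9 ⟨
  suc k ℕ.* 10         ∎
  where open ℕP.≤-Reasoning

theorem1p13 : Σ[ c ∈ ℚ ] (0ℚ < c ×
    (Σ[ T ∈ (ℕ → AdditiveTriple) ]
    ((∀ (B : ℕ) → ∃[ i ] B ≤ AdditiveTriple.n (T i) + AdditiveTriple.m (T i)) ×
    (∀ (i : ℕ) → let open AdditiveTriple (T i) in
    ∀ (h₁ h₂ h₃ : Fin n → ℝ) → IsOrderPreserver G₁ G₂ G₃ h₁ h₂ h₃ →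
    range h₁ h₂ h₃ ≥ℝ 2^ (c * (+ (n + m) / 1))))))
theorem1p13 =
  -- A triple with K levels has size 1 + 9K, which is at most 10K once K is positive; hence c =
  -- 1/10. Composing with `suc` skips the one-vertex triple, whose range is always 0.
  + 1 / 10 , ℚP.positive⁻¹ (+ 1 / 10) , triple ∘ suc , unbounded , λ k h₁ h₂ h₃ P j →
    let open AdditiveTriple (triple (suc k)) in
    ℚP.≤-trans (2^-≤ (+ 1 / 10 * (+ (n + m) / 1)) (suc k) (tenth-≤ (n + m) (suc k) (size-≤ k)) j)
               (range-exponential k P j)
  where
  unbounded : ∀ B → ∃[ k ] B ≤ AdditiveTriple.n (triple (suc k)) + AdditiveTriple.m (triple (suc k))
  unbounded B = B , ℕP.≤-trans (ℕP.m≤m*n B 3)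
    (ℕP.≤-trans (ℕP.m≤n+m (B ℕ.* 3) 4) (ℕP.m≤m+n _ (AdditiveTriple.m (triple (suc B)))))
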